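{- Let $1\le i<j\le N$. Then $|\mathbf{M}_{j,i}|=(-1)^{i-j}$ if $n_i$ is forward-connected to $n_j$, and $|\mathbf{M}_{j,i}|=0$ otherwise.
   Context: Let $G$ be a finite tree (connected acyclic simple graph) with nodes $n_0,n_1,\dots,n_N$, where $n_0$ is a terminal node (degree one) and the nodes are indexed so that along the path in $G$ from $n_0$ to any node $n_i$ the successively encountered node indices strictly increase. Node $n_i$ is forward-adjacent to $n_k$ if $n_i$ and $n_k$ are adjacent and $i<k$. Node $n_i$ is forward-connected to $n_j$ ($i<j$ necessarily) if there is a sequence of nodes $n_i=n_{l_0},n_{l_1},\dots,n_{l_m}=n_j$ with $m\ge 1$ in which each $n_{l_t}$ is forward-adjacent to $n_{l_{t+1}}$. The forward adjacency matrix $\mathbf{A}$ of $G$ is the $N\times N$ matrix, with rows and columns indexed by $1,\dots,N$, given by $\mathbf{A}(i,j)=1$ if $i=j$, $\mathbf{A}(i,j)=-1$ if $n_i$ is forward-adjacent to $n_j$, and $\mathbf{A}(i,j)=0$ otherwise. $\mathbf{M}_{j,i}$ is the $(N-1)\times(N-1)$ matrix obtained from $\mathbf{A}$ by deleting its $j$-th row and $i$-th column, and $|\cdot|$ denotes the determinant. -}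

module Defs where

open import Data.Fin.Base using (Fin; zero; suc; toℕ; punchIn; _<_)
open import Data.Fin.Properties using (_≟_; _<?_)
open import Data.Integer.Base as ℤ using (ℤ; 0ℤ; 1ℤ; -1ℤ; ∣_∣)
open import Data.Integer.Properties using (+-0-commutativeMonoid)
open import Data.List.Base using (List; length; filter; allFin; head; last)
open import Data.List.Relation.Unary.Linked using (Linked)
open import Data.List.Relation.Unary.Unique.Propositional using (Unique)
open import Data.Maybe.Base using (just)
open import Data.Nat.Base as ℕ using (ℕ; zero; suc)
open import Data.Product.Base using (_×_; ∃; ∃₂)
open import Data.Vec.Functional using (Vector)
open import Level using (0ℓ)
open import Relation.Binary.Construct.Closure.Transitive using (TransClosure)
open import Relation.Binary.Core using (Rel)
open import Relation.Binary.Definitions using (Decidable; Symmetric; Irreflexive)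
open import Relation.Binary.PropositionalEquality.Core using (_≡_)
open import Relation.Nullary.Decidable using (yes; no; _×-dec_)
open import Relation.Nullary.Negation using (¬_)
open import Algebra.Properties.CommutativeMonoid.Sum +-0-commutativeMonoid using (sum)

record SimpleGraph (n : ℕ) : Set₁ where
  field
    Adj    : Rel (Fin n) 0ℓ
    adj?   : Decidable Adj
    sym    : Symmetric Adj
    irrefl : Irreflexive _≡_ Adj

module _ {n : ℕ} (G : SimpleGraph n) where
  open SimpleGraph G

  degree : Fin n → ℕ
  degree v = length (filter (adj? v) (allFin n))

  record IsPath (u v : Fin n) (xs : List (Fin n)) : Set where
    field
      starts   : head xs ≡ just u
      ends     : last xs ≡ just v
      adjacent : Linked Adj xs
      distinct : Unique xs

  -- A cycle is listed without repeating its initial vertex at the end.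
  IsCycle : List (Fin n) → Set
  IsCycle xs = 3 ℕ.≤ length xs × ∃₂ λ u v → IsPath u v xs × Adj v u

  Connected : Set
  Connected = ∀ u v → ∃ λ xs → IsPath u v xs

  Acyclic : Set
  Acyclic = ∀ xs → ¬ IsCycle xs

  -- Nonemptiness is not required here; below, trees have a vertex zero.
  IsTree : Set
  IsTree = Connected × Acyclic

  ForwardAdjacent : Rel (Fin n) 0ℓ
  ForwardAdjacent u v = Adj u v × u < v

  forwardAdjacent? : Decidable ForwardAdjacent
  forwardAdjacent? u v = adj? u v ×-dec u <? v

  ForwardConnected : Rel (Fin n) 0ℓ
  ForwardConnected = TransClosure ForwardAdjacent

IncreasingFromRoot : ∀ {n} → SimpleGraph (suc n) → Set
IncreasingFromRoot G = ∀ v xs → IsPath G zero v xs → Linked _<_ xs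

Matrix : ℕ → ℕ → Set
Matrix m n = Vector (Vector ℤ n) m

minor : ∀ {m n} → Matrix (suc m) (suc n) → Fin (suc m) → Fin (suc n) → Matrix m n
minor A r c k l = A (punchIn r k) (punchIn c l)

-- Laplace expansion along the first row.
det : ∀ {n} → Matrix n n → ℤ
det {zero}  A = 1ℤ
det {suc n} A = sum λ c → (-1ℤ ℤ.^ toℕ c) ℤ.* A zero c ℤ.* det (minor A zero c)

-- Integer powers of -1: since -1 is its own inverse, (-1)^k = (-1)^|k|.
-1^_ : ℤ → ℤ
-1^ k = -1ℤ ℤ.^ ∣ k ∣

-- The vertices n₀ , … , n_N are Fin (suc N).  The rows and columns 1 , … , N
-- are Fin N, with i : Fin N standing for the vertex suc i.
forwardAdjacencyMatrix : ∀ {N} → SimpleGraph (suc N) → Matrix N N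
forwardAdjacencyMatrix G i j with i ≟ j
... | yes _ = 1ℤ
... | no  _ with forwardAdjacent? G (suc i) (suc j)
...   | yes _ = -1ℤ
...   | no  _ = 0ℤ

{-# OPTIONS --safe #-}
module Submission where

-- Two facts carry the proof.  Every vertex has at most one forward-adjacent
-- predecessor: if u < v < w with u and v both adjacent to w, then extending
-- the increasing path from the root to u by w and v gives a path from the root
-- which decreases at its last step.  And the minors of the upper unitriangular
-- matrix A obey a recursion: when row and column 0 survive, they can be
-- stripped off; when column 0 is deleted, expansion along row 0 is a sum over
-- the successors c of vertex 0, of which at most one lies on a path to j.

open import Defs
open import Data.Fin.Base using (Fin; zero; suc; toℕ; _<_; _≤_; punchIn)
open import Data.Fin.Properties using (_≟_; <-cmp; <⇒≢; <-irrefl; <-asym; ≤-refl; ≤-trans; punchInᵢ≢i; suc-injective)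
open import Data.Integer.Base as ℤ using (ℤ; +_; _-_; 0ℤ; 1ℤ; -1ℤ)
open import Data.Integer.Properties as ℤₚ using (+-0-commutativeMonoid)
open import Data.List.Base using (List; []; _∷_; _++_; head; last)
open import Data.List.Membership.Propositional using (_∈_)
open import Data.List.Relation.Unary.All using ([]; _∷_)
open import Data.List.Relation.Unary.AllPairs using ([]; _∷_)
open import Data.List.Relation.Unary.Any using (here; there)
open import Data.List.Relation.Unary.Linked as Linked using (Linked; []; [-]; _∷_)
open import Data.List.Relation.Unary.Linked.Properties as Linkedₚ using ()
open import Data.List.Relation.Unary.Unique.Propositional.Properties as Uniqueₚ using ()
open import Data.Maybe.Base using (just)
open import Data.Maybe.Relation.Binary.Connected as Maybe using ()
open import Data.Nat.Base as ℕ using (ℕ; zero; suc; s≤s; s≤s⁻¹)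
open import Data.Nat.Properties as ℕₚ using (<⇒≤; <⇒≱)
open import Data.Product.Base using (_×_; _,_; proj₁; proj₂)
open import Data.Sum.Base using (_⊎_; inj₁; inj₂)
open import Function.Base using (_∘_; _on_; id)
open import Level using (0ℓ)
open import Relation.Binary.Construct.Closure.ReflexiveTransitive using (Star; ε; _◅_; gmap)
open import Relation.Binary.Construct.Closure.Transitive using (TransClosure; [_]; _∷_)
open import Relation.Binary.Core using (Rel; _⇒_)
open import Relation.Binary.Definitions using (Decidable; tri<; tri≈; tri>)
open import Relation.Binary.PropositionalEquality using (_≢_; refl; sym; trans; cong; cong₂; subst; ≢-sym; module ≡-Reasoning)
open import Relation.Binary.PropositionalEquality.Core using (_≡_)
open import Relation.Nullary.Decidable using (yes; no)
open import Relation.Nullary.Negation using (¬_; contradiction)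
open import Algebra.Properties.CommutativeMonoid.Sum +-0-commutativeMonoid using (sum; sum-cong-≗; sum-remove; sum-replicate-zero)

-- Sums and determinants

sum-zero : ∀ {n} (f : Fin n → ℤ) → (∀ c → f c ≡ 0ℤ) → sum f ≡ 0ℤ
sum-zero {n} f f≡0 =
  trans (sum-cong-≗ f≡0) (sum-replicate-zero n)

sum-single : ∀ {n} (f : Fin n → ℤ) k → (∀ c → c ≢ k → f c ≡ 0ℤ) → sum f ≡ f k
sum-single {suc n} f k f≡0 = begin
  sum f                          ≡⟨ sum-remove {i = k} f ⟩
  f k ℤ.+ sum (f ∘ punchIn k)    ≡⟨ cong (λ s → f k ℤ.+ s) (sum-zero _ (λ c → f≡0 _ (punchInᵢ≢i k c))) ⟩
  f k ℤ.+ 0ℤ                     ≡⟨ ℤₚ.+-identityʳ (f k) ⟩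
  f k                            ∎
  where open ≡-Reasoning

x*0*y≡0 : ∀ x {a} y → a ≡ 0ℤ → x ℤ.* a ℤ.* y ≡ 0ℤ
x*0*y≡0 x y refl = cong (ℤ._* y) (ℤₚ.*-zeroʳ x)

x*a*0≡0 : ∀ x a {y} → y ≡ 0ℤ → x ℤ.* a ℤ.* y ≡ 0ℤ
x*a*0≡0 x a refl = ℤₚ.*-zeroʳ (x ℤ.* a)

-- In the expansion along row zero, the summand of column zero contains a zero entry, and every
-- other minor keeps the vanishing column, so induction applies.
det-zeroColumn : ∀ {n} (A : Matrix (suc n) (suc n)) → (∀ k → A k zero ≡ 0ℤ) → det A ≡ 0ℤ
det-zeroColumn {n} A A≡0 = sum-zero _ (term n A A≡0)
  where
  -- Matching on `n` shows that a column `suc c` forces size at least two, so that the minor has a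
  -- column zero.
  term : ∀ n (A : Matrix (suc n) (suc n)) → (∀ k → A k zero ≡ 0ℤ) → ∀ c →
         (-1ℤ ℤ.^ toℕ c) ℤ.* A zero c ℤ.* det (minor A zero c) ≡ 0ℤ
  term n       A A≡0 zero    = x*0*y≡0 1ℤ (det (minor A zero zero)) (A≡0 zero)
  term (suc n) A A≡0 (suc c) = x*a*0≡0 (-1ℤ ℤ.^ suc (toℕ c)) (A zero (suc c))
    (det-zeroColumn (minor A zero (suc c)) (λ k → A≡0 (suc k)))

-- A minor at any column but zero retains the part of column zero below the corner, which vanishes;
-- only the corner summand survives.
det-unitColumn : ∀ {n} (A : Matrix (suc n) (suc n)) → A zero zero ≡ 1ℤ →
                 (∀ k → A (suc k) zero ≡ 0ℤ) → det A ≡ det (minor A zero zero)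
det-unitColumn {n} A A₀₀≡1 A≡0 = begin
  det A                                            ≡⟨ sum-single _ zero (term n A A≡0) ⟩
  1ℤ ℤ.* A zero zero ℤ.* det (minor A zero zero)   ≡⟨ cong (λ a → 1ℤ ℤ.* a ℤ.* det (minor A zero zero)) A₀₀≡1 ⟩
  1ℤ ℤ.* det (minor A zero zero)                   ≡⟨ ℤₚ.*-identityˡ _ ⟩
  det (minor A zero zero)                          ∎
  where
  open ≡-Reasoning
  term : ∀ n (A : Matrix (suc n) (suc n)) → (∀ k → A (suc k) zero ≡ 0ℤ) → ∀ c → c ≢ zero →
         (-1ℤ ℤ.^ toℕ c) ℤ.* A zero c ℤ.* det (minor A zero c) ≡ 0ℤ
  term n       A A≡0 zero    c≢0 = contradiction refl c≢0
  term (suc n) A A≡0 (suc c) _   = x*a*0≡0 (-1ℤ ℤ.^ suc (toℕ c)) (A zero (suc c))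
    (det-zeroColumn (minor A zero (suc c)) A≡0)

-- Powers of -1

-1^[m+m]≡1 : ∀ m → -1ℤ ℤ.^ (m ℕ.+ m) ≡ 1ℤ
-1^[m+m]≡1 zero    = refl
-1^[m+m]≡1 (suc m) = begin
  -1ℤ ℤ.* -1ℤ ℤ.^ (m ℕ.+ suc m)          ≡⟨ cong (λ k → -1ℤ ℤ.* -1ℤ ℤ.^ k) (ℕₚ.+-suc m m) ⟩
  -1ℤ ℤ.* (-1ℤ ℤ.* -1ℤ ℤ.^ (m ℕ.+ m))    ≡⟨ cong (λ x → -1ℤ ℤ.* (-1ℤ ℤ.* x)) (-1^[m+m]≡1 m) ⟩
  1ℤ                                     ∎
  where open ≡-Reasoning

-1^[m+[m+n]]≡-1^n : ∀ m n → -1ℤ ℤ.^ (m ℕ.+ (m ℕ.+ n)) ≡ -1ℤ ℤ.^ n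
-1^[m+[m+n]]≡-1^n m n = begin
  -1ℤ ℤ.^ (m ℕ.+ (m ℕ.+ n))            ≡⟨ cong (-1ℤ ℤ.^_) (sym (ℕₚ.+-assoc m m n)) ⟩
  -1ℤ ℤ.^ (m ℕ.+ m ℕ.+ n)              ≡⟨ ℤₚ.^-distribˡ-+-* -1ℤ (m ℕ.+ m) n ⟩
  -1ℤ ℤ.^ (m ℕ.+ m) ℤ.* -1ℤ ℤ.^ n      ≡⟨ cong (ℤ._* -1ℤ ℤ.^ n) (-1^[m+m]≡1 m) ⟩
  1ℤ ℤ.* -1ℤ ℤ.^ n                     ≡⟨ ℤₚ.*-identityˡ _ ⟩
  -1ℤ ℤ.^ n                            ∎
  where open ≡-Reasoning

-- Combines the sign of column `m` in the expansion, the edge entry -1 and the sign of the smaller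
-- minor; the two copies of `m` cancel in parity.
-1^m*-1*-1^[m+n] : ∀ m n → -1ℤ ℤ.^ m ℤ.* -1ℤ ℤ.* -1ℤ ℤ.^ (m ℕ.+ n) ≡ -1ℤ ℤ.^ suc n
-1^m*-1*-1^[m+n] m n = begin
  -1ℤ ℤ.^ m ℤ.* -1ℤ ℤ.* -1ℤ ℤ.^ (m ℕ.+ n)    ≡⟨ ℤₚ.*-assoc (-1ℤ ℤ.^ m) -1ℤ _ ⟩
  -1ℤ ℤ.^ m ℤ.* -1ℤ ℤ.^ suc (m ℕ.+ n)        ≡⟨ ℤₚ.^-distribˡ-+-* -1ℤ m (suc (m ℕ.+ n)) ⟨
  -1ℤ ℤ.^ (m ℕ.+ suc (m ℕ.+ n))              ≡⟨ cong (λ k → -1ℤ ℤ.^ (m ℕ.+ k)) (sym (ℕₚ.+-suc m n)) ⟩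
  -1ℤ ℤ.^ (m ℕ.+ (m ℕ.+ suc n))              ≡⟨ -1^[m+[m+n]]≡-1^n m (suc n) ⟩
  -1ℤ ℤ.^ suc n                              ∎
  where open ≡-Reasoning

-1^[1+m+1+n]≡-1^[m+n] : ∀ m n → -1ℤ ℤ.^ (suc m ℕ.+ suc n) ≡ -1ℤ ℤ.^ (m ℕ.+ n)
-1^[1+m+1+n]≡-1^[m+n] m n = trans
  (cong (λ k → -1ℤ ℤ.^ suc k) (ℕₚ.+-suc m n))
  (-1^[m+[m+n]]≡-1^n 1 (m ℕ.+ n))

-- The induction on minors uses sums as exponents, which stay natural numbers. Parity is unaffected,
-- as m + n = 2m + (n - m).
-1^[m+n]≡-1^[m-n] : ∀ {m n} → m ℕ.≤ n → -1ℤ ℤ.^ (m ℕ.+ n) ≡ -1^ (+ m - + n)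
-1^[m+n]≡-1^[m-n] {m} {n} m≤n = begin
  -1ℤ ℤ.^ (m ℕ.+ n)                    ≡⟨ cong (λ k → -1ℤ ℤ.^ (m ℕ.+ k)) (sym (ℕₚ.m+[n∸m]≡n m≤n)) ⟩
  -1ℤ ℤ.^ (m ℕ.+ (m ℕ.+ (n ℕ.∸ m)))    ≡⟨ -1^[m+[m+n]]≡-1^n m (n ℕ.∸ m) ⟩
  -1ℤ ℤ.^ (n ℕ.∸ m)                    ≡⟨ cong (-1ℤ ℤ.^_) (sym (ℤₚ.∣⊖∣-≤ m≤n)) ⟩
  -1^ (m ℤ.⊖ n)                        ≡⟨ cong -1^_ (sym (ℤₚ.[+m]-[+n]≡m⊖n m n)) ⟩
  -1^ (+ m - + n)                      ∎
  where open ≡-Reasoning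

-- Increasing forests

-- Deleting vertex zero can disconnect a tree, but the properties below survive it, so the induction
-- carries these.
record IsIncreasingForest {n} (E : Rel (Fin n) 0ℓ) : Set where
  field
    edge?         : Decidable E
    increasing    : E ⇒ _<_
    unique-parent : ∀ {u v w} → E u w → E v w → u ≡ v

Star⇒≤ : ∀ {n} {E : Rel (Fin n) 0ℓ} → E ⇒ _<_ → Star E ⇒ _≤_
Star⇒≤ E⇒< ε        = ≤-refl
Star⇒≤ E⇒< (e ◅ es) = ≤-trans (<⇒≤ (E⇒< e)) (Star⇒≤ E⇒< es)

-- Increasing edges never enter vertex zero, so deleting it loses no walk between the others.
Star-on-suc : ∀ {n} {E : Rel (Fin (suc n)) 0ℓ} → E ⇒ _<_ →
              ∀ {u v} → Star E (suc u) (suc v) → Star (E on suc) u v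
Star-on-suc E⇒< ε                        = ε
Star-on-suc E⇒< (_◅_ {j = suc _}  e es)  = e ◅ Star-on-suc E⇒< es
Star-on-suc E⇒< (_◅_ {j = zero}   e es)  = contradiction (E⇒< e) λ ()

isIncreasingForest-on-suc : ∀ {n} {E : Rel (Fin (suc n)) 0ℓ} →
                            IsIncreasingForest E → IsIncreasingForest (E on suc)
isIncreasingForest-on-suc F = record
  { edge?         = λ u v → edge? (suc u) (suc v)
  ; increasing    = λ e → s≤s⁻¹ (increasing e)
  ; unique-parent = λ e e′ → suc-injective (unique-parent e e′)
  }
  where open IsIncreasingForest F

module _ {n} {E : Rel (Fin n) 0ℓ} (F : IsIncreasingForest E) where
  open IsIncreasingForest F

  -- A nonempty walk to `c` must arrive through the only parent `r`.
  ancestor-of-child : ∀ {r c x} → E r c → Star E x c → x ≡ c ⊎ Star E x r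
  ancestor-of-child r→c ε = inj₁ refl
  ancestor-of-child r→c (x→y ◅ y→*c) with ancestor-of-child r→c y→*c
  ... | inj₂ y→*r = inj₂ (x→y ◅ y→*r)
  ... | inj₁ refl with refl ← unique-parent x→y r→c = inj₂ ε

  -- The ancestors of `j` form a chain. Induction on the first walk: if `y` reaches its second
  -- vertex `z`, then `y` is `z` or already reaches the parent `x`.
  ancestors-comparable : ∀ {x y j} → Star E x j → Star E y j → Star E x y ⊎ Star E y x
  ancestors-comparable ε              y→*j = inj₂ y→*j
  ancestors-comparable (x→z ◅ z→*j) y→*j with ancestors-comparable z→*j y→*j
  ... | inj₁ z→*y = inj₁ (x→z ◅ z→*y)
  ... | inj₂ y→*z with ancestor-of-child x→z y→*z
  ...   | inj₁ refl = inj₁ (x→z ◅ ε)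
  ...   | inj₂ y→*x = inj₂ y→*x

  -- A nonempty walk from `c` to `d` would pass through the parent `r` of `d`, yet `r` is smaller
  -- than `c`.
  siblings-unrelated : ∀ {r c d} → E r c → E r d → Star E c d → c ≡ d
  siblings-unrelated r→c r→d c→*d with ancestor-of-child r→d c→*d
  ... | inj₁ c≡d  = c≡d
  ... | inj₂ c→*r = contradiction (Star⇒≤ increasing c→*r) (<⇒≱ (increasing r→c))

  unique-branch : ∀ {r c d j} → E r c → E r d → Star E c j → Star E d j → c ≡ d
  unique-branch r→c r→d c→*j d→*j with ancestors-comparable c→*j d→*j
  ... | inj₁ c→*d = siblings-unrelated r→c r→d c→*d
  ... | inj₂ d→*c = sym (siblings-unrelated r→d r→c d→*c)

-- Minors of the matrix of an increasing forest

-- Prescribing the entries by a relation on the indices themselves gives a class of matrices closed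
-- under deleting row and column zero.
record IsForwardMatrix {n} (E : Rel (Fin n) 0ℓ) (A : Matrix n n) : Set where
  field
    diagonal : ∀ i → A i i ≡ 1ℤ
    edge     : ∀ {i j} → E i j → A i j ≡ -1ℤ
    non-edge : ∀ {i j} → i ≢ j → ¬ E i j → A i j ≡ 0ℤ

isForwardMatrix-on-suc : ∀ {n} {E : Rel (Fin (suc n)) 0ℓ} {A} → IsForwardMatrix E A →
                         IsForwardMatrix (E on suc) (minor A zero zero)
isForwardMatrix-on-suc M = record
  { diagonal = λ i → diagonal (suc i)
  ; edge     = edge
  ; non-edge = λ i≢j → non-edge (i≢j ∘ suc-injective)
  }
  where open IsForwardMatrix M

firstColumn : ∀ {n} {E : Rel (Fin (suc n)) 0ℓ} {A} → IsIncreasingForest E → IsForwardMatrix E A →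
              ∀ k → A (suc k) zero ≡ 0ℤ
firstColumn F M k = non-edge (λ ()) λ e → contradiction (increasing e) λ ()
  where
  open IsIncreasingForest F
  open IsForwardMatrix M

det-forwardMatrix : ∀ {n} {E : Rel (Fin n) 0ℓ} {A} → IsIncreasingForest E → IsForwardMatrix E A →
                    det A ≡ 1ℤ
det-forwardMatrix {zero}          F M = refl
det-forwardMatrix {suc n} {A = A} F M = trans
  (det-unitColumn A (IsForwardMatrix.diagonal M zero) (firstColumn F M))
  (det-forwardMatrix (isIncreasingForest-on-suc F) (isForwardMatrix-on-suc M))

-- The order of `i` and `j` is left free, and `Star` admits the diagonal, because the column `c` of
-- the row expansion may lie before, at or after `j`.
det-minor : ∀ {n} {E : Rel (Fin (suc n)) 0ℓ} {A} → IsIncreasingForest E → IsForwardMatrix E A →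
            ∀ i j →
            (Star E i j → det (minor A j i) ≡ -1ℤ ℤ.^ (toℕ i ℕ.+ toℕ j)) ×
            (¬ Star E i j → det (minor A j i) ≡ 0ℤ)
det-minor F M zero zero =
  (λ _ → det-forwardMatrix (isIncreasingForest-on-suc F) (isForwardMatrix-on-suc M)) ,
  (λ ¬0→*0 → contradiction ε ¬0→*0)
-- Row zero goes but column zero stays, which leaves a zero column.
det-minor {suc n} {A = A} F M (suc i) zero =
  (λ i→*0 → contradiction (Star⇒≤ (IsIncreasingForest.increasing F) i→*0) λ ()) ,
  (λ _ → det-zeroColumn (minor A zero (suc i)) (firstColumn F M))
det-minor {suc n} {E} {A} F M (suc i) (suc j) =
  (λ i→*j → begin
    det (minor A (suc j) (suc i))                      ≡⟨ strip ⟩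
    det (minor (minor A zero zero) j i)                ≡⟨ proj₁ rec (Star-on-suc increasing i→*j) ⟩
    -1ℤ ℤ.^ (toℕ i ℕ.+ toℕ j)                          ≡⟨ -1^[1+m+1+n]≡-1^[m+n] (toℕ i) (toℕ j) ⟨
    -1ℤ ℤ.^ (toℕ (suc i) ℕ.+ toℕ (suc j))              ∎) ,
  (λ ¬i→*j → trans strip (proj₂ rec (¬i→*j ∘ gmap suc id)))
  where
  open ≡-Reasoning
  open IsIncreasingForest F using (increasing)
  rec = det-minor (isIncreasingForest-on-suc F) (isForwardMatrix-on-suc M) i j
  strip : det (minor A (suc j) (suc i)) ≡ det (minor (minor A zero zero) j i)
  strip = det-unitColumn (minor A (suc j) (suc i)) (IsForwardMatrix.diagonal M zero)
                         (λ k → firstColumn F M (punchIn j k))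
det-minor {suc n} {E} {A} F M zero (suc j) = connected , disconnected
  where
  open ≡-Reasoning
  open IsIncreasingForest F
  open IsForwardMatrix M

  rec = λ c → det-minor (isIncreasingForest-on-suc F) (isForwardMatrix-on-suc M) c j

  -- The determinant unfolds to `sum term` by definition: deleting row `suc j` and column zero, then
  -- row zero and column `c`, amounts to deleting row and column zero, then row `j` and column `c`.
  term : Fin (suc n) → ℤ
  term c = -1ℤ ℤ.^ toℕ c ℤ.* A zero (suc c) ℤ.* det (minor (minor A zero zero) j c)

  term-zero : ∀ c → ¬ (E zero (suc c) × Star E (suc c) (suc j)) → term c ≡ 0ℤ
  term-zero c ¬branch with edge? zero (suc c)
  ... | no ¬e = x*0*y≡0 (-1ℤ ℤ.^ toℕ c) (det (minor (minor A zero zero) j c)) (non-edge (λ ()) ¬e)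
  ... | yes e = x*a*0≡0 (-1ℤ ℤ.^ toℕ c) (A zero (suc c))
                        (proj₂ (rec c) (λ c→*j → ¬branch (e , gmap suc id c→*j)))

  connected : Star E zero (suc j) → sum term ≡ -1ℤ ℤ.^ suc (toℕ j)
  connected (_◅_ {j = zero}  e _)    = contradiction (increasing e) λ ()
  -- The first edge of the walk selects `c`; any other nonzero summand would give a second child of
  -- vertex zero from which `suc j` is reached.
  connected (_◅_ {j = suc c} e c→*j) = begin
    sum term
      ≡⟨ sum-single term c (λ d d≢c → term-zero d λ (e′ , d→*j) →
           d≢c (suc-injective (unique-branch F e′ e d→*j c→*j))) ⟩
    -1ℤ ℤ.^ toℕ c ℤ.* A zero (suc c) ℤ.* det (minor (minor A zero zero) j c)
      ≡⟨ cong₂ (λ a d → -1ℤ ℤ.^ toℕ c ℤ.* a ℤ.* d) (edge e) (proj₁ (rec c) (Star-on-suc increasing c→*j)) ⟩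
    -1ℤ ℤ.^ toℕ c ℤ.* -1ℤ ℤ.* -1ℤ ℤ.^ (toℕ c ℕ.+ toℕ j)
      ≡⟨ -1^m*-1*-1^[m+n] (toℕ c) (toℕ j) ⟩
    -1ℤ ℤ.^ suc (toℕ j) ∎

  disconnected : ¬ Star E zero (suc j) → sum term ≡ 0ℤ
  disconnected ¬0→*j = sum-zero term λ c → term-zero c λ (e , c→*j) → ¬0→*j (e ◅ c→*j)

-- Paths and forward adjacency

head-++ : ∀ {A : Set} {x : A} xs ys → head xs ≡ just x → head (xs ++ ys) ≡ just x
head-++ (_ ∷ _) ys eq = eq

last-++-∷ : ∀ {A : Set} (xs : List A) y ys → last (xs ++ y ∷ ys) ≡ last (y ∷ ys)
last-++-∷ []            y ys = refl
last-++-∷ (x ∷ [])      y ys = refl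
last-++-∷ (x ∷ z ∷ xs)  y ys = last-++-∷ (z ∷ xs) y ys

Linked-++⁻ʳ : ∀ {A : Set} {R : Rel A 0ℓ} xs {ys} → Linked R (xs ++ ys) → Linked R ys
Linked-++⁻ʳ []       l = l
Linked-++⁻ʳ (x ∷ xs) l = Linked-++⁻ʳ xs (Linked.tail l)

∈⇒≤last : ∀ {n} {u x : Fin n} {xs} → Linked _<_ xs → last xs ≡ just u → x ∈ xs → x ≤ u
∈⇒≤last [-]        refl (here refl)  = ≤-refl
∈⇒≤last (x<y ∷ l)  eq   (here refl)  = ≤-trans (<⇒≤ x<y) (∈⇒≤last l eq (here refl))
∈⇒≤last (_ ∷ l)    eq   (there x∈xs) = ∈⇒≤last l eq x∈xs

module _ {n} (G : SimpleGraph (suc n)) (connected : Connected G) (inc : IncreasingFromRoot G) where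
  open SimpleGraph G renaming (sym to Adj-sym)

  -- The path to the smaller neighbour `u` is the one to extend: its vertices are all at most `u`,
  -- so both `w` and `v` are new to it.
  no-smaller-parent : ∀ {u v w} → u < v → ForwardAdjacent G u w → ¬ ForwardAdjacent G v w
  no-smaller-parent {u} {v} {w} u<v (uw , u<w) (vw , v<w) with connected zero u
  ... | xs , p = <-asym v<w (Linked.head (Linked-++⁻ʳ xs (inc v (xs ++ w ∷ v ∷ []) extended)))
    where
    open IsPath p
    ≤u : ∀ {x} → x ∈ xs → x ≤ u
    ≤u = ∈⇒≤last (inc u xs p) ends
    extended : IsPath G zero v (xs ++ w ∷ v ∷ [])
    extended = record
      { starts   = head-++ xs _ starts
      ; ends     = last-++-∷ xs w (v ∷ [])
      ; adjacent = Linkedₚ.++⁺ adjacent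
                     (subst (λ m → Maybe.Connected Adj m (just w)) (sym ends) (Maybe.just uw))
                     (Adj-sym vw ∷ [-])
      ; distinct = Uniqueₚ.++⁺ distinct ((≢-sym (<⇒≢ v<w) ∷ []) ∷ [] ∷ []) λ where
          (x∈xs , here refl)         → <⇒≱ u<w (≤u x∈xs)
          (x∈xs , there (here refl)) → <⇒≱ u<v (≤u x∈xs)
      }

  forwardAdjacent-isIncreasingForest : IsIncreasingForest (ForwardAdjacent G)
  forwardAdjacent-isIncreasingForest = record
    { edge?         = forwardAdjacent? G
    ; increasing    = proj₂
    ; unique-parent = parent
    }
    where
    parent : ∀ {u v w} → ForwardAdjacent G u w → ForwardAdjacent G v w → u ≡ v
    parent {u} {v} e e′ with <-cmp u v
    ... | tri< u<v _ _ = contradiction e′ (no-smaller-parent u<v e)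
    ... | tri≈ _ u≡v _ = u≡v
    ... | tri> _ _ v<u = contradiction e (no-smaller-parent v<u e′)

-- The forward adjacency matrix and its minors

forwardAdjacencyMatrix-isForwardMatrix : ∀ {n} (G : SimpleGraph (suc n)) →
  IsForwardMatrix (ForwardAdjacent G on suc) (forwardAdjacencyMatrix G)
forwardAdjacencyMatrix-isForwardMatrix G = record
  { diagonal = diagonal ; edge = edge ; non-edge = non-edge }
  where
  diagonal : ∀ i → forwardAdjacencyMatrix G i i ≡ 1ℤ
  diagonal i with i ≟ i
  ... | yes _   = refl
  ... | no  i≢i = contradiction refl i≢i

  edge : ∀ {i j} → ForwardAdjacent G (suc i) (suc j) → forwardAdjacencyMatrix G i j ≡ -1ℤ
  edge {i} {j} e with i ≟ j
  ... | yes refl = contradiction (proj₂ e) (<-irrefl refl)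
  ... | no  _ with forwardAdjacent? G (suc i) (suc j)
  ...   | yes _ = refl
  ...   | no ¬e = contradiction e ¬e

  non-edge : ∀ {i j} → i ≢ j → ¬ ForwardAdjacent G (suc i) (suc j) → forwardAdjacencyMatrix G i j ≡ 0ℤ
  non-edge {i} {j} i≢j ¬e with i ≟ j
  ... | yes i≡j = contradiction i≡j i≢j
  ... | no  _ with forwardAdjacent? G (suc i) (suc j)
  ...   | yes e = contradiction e ¬e
  ...   | no  _ = refl

TransClosure⇒Star : ∀ {A : Set} {R : Rel A 0ℓ} → TransClosure R ⇒ Star R
TransClosure⇒Star [ r ]    = r ◅ ε
TransClosure⇒Star (r ∷ rs) = r ◅ TransClosure⇒Star rs

-- Forward-connectedness demands at least one edge; distinct endpoints rule out the empty walk.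
Star⇒TransClosure : ∀ {A : Set} {R : Rel A 0ℓ} {x y} → x ≢ y → Star R x y → TransClosure R x y
Star⇒TransClosure x≢y ε        = contradiction refl x≢y
Star⇒TransClosure x≢y (r ◅ rs) = r ◅⁺ rs
  where
  _◅⁺_ : ∀ {A : Set} {R : Rel A 0ℓ} {x y z} → R x y → Star R y z → TransClosure R x z
  r ◅⁺ ε        = [ r ]
  r ◅⁺ (s ◅ rs) = r ∷ (s ◅⁺ rs)

lemma12 : ∀ (n : ℕ) (G : SimpleGraph (suc (suc n))) →
    IsTree G → degree G zero ≡ 1 → IncreasingFromRoot G →
    ∀ (i j : Fin (suc n)) → i < j →
    (ForwardConnected G (suc i) (suc j) →
    det (minor (forwardAdjacencyMatrix G) j i) ≡ -1^ (+ toℕ (suc i) - + toℕ (suc j)))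
    × (¬ ForwardConnected G (suc i) (suc j) →
    det (minor (forwardAdjacencyMatrix G) j i) ≡ 0ℤ)
lemma12 n G (connected , _) _ inc i j i<j =
  (λ i→⁺j → begin
    det (minor (forwardAdjacencyMatrix G) j i)
      ≡⟨ proj₁ minors (Star-on-suc proj₂ (TransClosure⇒Star i→⁺j)) ⟩
    -1ℤ ℤ.^ (toℕ i ℕ.+ toℕ j)
      ≡⟨ -1^[1+m+1+n]≡-1^[m+n] (toℕ i) (toℕ j) ⟨
    -1ℤ ℤ.^ (toℕ (suc i) ℕ.+ toℕ (suc j))
      ≡⟨ -1^[m+n]≡-1^[m-n] (s≤s (<⇒≤ i<j)) ⟩
    -1^ (+ toℕ (suc i) - + toℕ (suc j)) ∎) ,
  (λ ¬i→⁺j → proj₂ minors λ i→*j →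
    ¬i→⁺j (Star⇒TransClosure (<⇒≢ i<j ∘ suc-injective) (gmap suc id i→*j)))
  where
  open ≡-Reasoning
  -- The root indexes no row or column, so it is removed from the forest first.
  minors = det-minor
    (isIncreasingForest-on-suc (forwardAdjacent-isIncreasingForest G connected inc))
    (forwardAdjacencyMatrix-isForwardMatrix G) i j
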